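{- The hereditary class property "nowhere dense" (the set of hereditary nowhere dense classes) is a decomposition horizon.
   Context: Graphs are finite and simple. For a graph $H$ and integer $p\ge0$, $H^{(p)}$ is obtained by replacing each edge of $H$ by a path of length $p+1$. A class $\mathscr C$ is nowhere dense if there is a function $f_\omega:\mathbb N\to\mathbb N$ such that whenever $H^{(p)}$ is a subgraph of a graph in $\mathscr C$, the clique number of $H$ is at most $f_\omega(p)$. A hereditary class is a class closed under isomorphism and induced subgraphs; a hereditary class property is a set $\Pi$ of hereditary classes closed under passing to hereditary subclasses. For non-decreasing $f$ and positive integer $p$, $\mathscr C$ has an $f$-bounded $\Pi$-decomposition with parameter $p$ if there is $\mathscr D_p\in\Pi$ such that every $G\in\mathscr C$ has a partition $V_1,\dots,V_N$ of $V(G)$, $N\le f(|G|)$, with $G[V_{i_1}\cup\dots\cup V_{i_p}]\in\mathscr D_p$ for all $i_1,\dots,i_p\in[N]$. $\Pi^\ast$ is the set of hereditary classes that, for every positive integer $p$, have such a decomposition for some non-decreasing $f$ with $f(n)=n^{o(1)}$. $\Pi$ is a decomposition horizon if $\Pi^\ast=\Pi$. -}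

module Defs where

open import Level using (Level; 0ℓ; _⊔_) renaming (suc to lsuc)
open import Data.Nat using (ℕ; zero; suc; _+_; _*_; _^_; _≤_; NonZero)
open import Data.Fin using (Fin; zero; suc; inject₁; _↑ˡ_; _↑ʳ_; combine; splitAt)
  renaming (_<_ to _<ᶠ_)
open import Data.Fin.Properties
  using (any?; _<?_; <⇒≢; ↑ˡ-injective; ↑ʳ-injective; combine-injectiveʳ; splitAt-↑ˡ; splitAt-↑ʳ)
  renaming (_≟_ to _≟ᶠ_)
open import Data.Fin.Subset using (Subset; _∈_; ∣_∣; ⋃; Nonempty; inside; outside)
open import Data.List as List using (List)
open import Data.List.Membership.Propositional.Properties using (∈-lookup)
import Data.List.Relation.Unary.All as ListAll
open import Data.List.Relation.Unary.All.Properties using (all-filter)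
open import Data.Product using (Σ; ∃; ∃!; _×_; _,_; proj₁; proj₂)
open import Data.Sum using (_⊎_; inj₁; inj₂; swap)
open import Data.Vec as Vec using (Vec; []; _∷_; _∷ʳ_; lookup; tabulate)
open import Data.Vec.Relation.Unary.All as All using (All; []; _∷_)
import Data.Vec.Relation.Unary.All.Properties as All
open import Data.Vec.Relation.Unary.AllPairs using (AllPairs; []; _∷_)
import Data.Vec.Relation.Unary.AllPairs.Properties as AllPairs
open import Function using (_∘_; _on_)
open import Function.Bundles using (_↔_; _⇔_; Inverse)
open import Function.Definitions using (Injective)
open import Relation.Binary.Core using (Rel; _Preserves_⟶_)
open import Relation.Binary.Definitions using (Decidable; Symmetric; Irreflexive)
open import Relation.Binary.PropositionalEquality
  using (_≡_; _≢_; refl; sym; trans; cong)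
open import Relation.Nullary using (¬_)
open import Relation.Nullary.Decidable using (_×-dec_; _⊎-dec_)
open import Relation.Unary as Unary using (Pred; _⊆_)

record Graph : Set₁ where
  field
    order  : ℕ
    Adj    : Rel (Fin order) 0ℓ
    adj?   : Decidable Adj
    adj-sym    : Symmetric Adj
    adj-irrefl : Irreflexive _≡_ Adj

open Graph public

record _≅_ (G H : Graph) : Set where
  field
    bijection : Fin (order G) ↔ Fin (order H)
    adj-iff   : ∀ u v → Adj G u v ⇔
                Adj H (Inverse.to bijection u) (Inverse.to bijection v)

-- H is, up to isomorphism, a (not necessarily induced) subgraph of G.
record _IsSubgraphOf_ (H G : Graph) : Set where
  field
    embed     : Fin (order H) → Fin (order G)
    injective : Injective _≡_ _≡_ embed
    adj-mono  : ∀ {u v} → Adj H u v → Adj G (embed u) (embed v)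

-- The elements of S in increasing order.
elements : ∀ {n} (S : Subset n) → Fin ∣ S ∣ → Fin n
elements (inside  ∷ S) zero    = zero
elements (inside  ∷ S) (suc i) = suc (elements S i)
elements (outside ∷ S) i       = suc (elements S i)

_[_] : (G : Graph) → Subset (order G) → Graph
G [ S ] = record
  { order      = ∣ S ∣
  ; Adj        = Adj G on elements S
  ; adj?       = λ u v → adj? G (elements S u) (elements S v)
  ; adj-sym    = adj-sym G
  ; adj-irrefl = λ eq → adj-irrefl G (cong (elements S) eq)
  }

IsClique : (G : Graph) → Subset (order G) → Set
IsClique G S = ∀ {u v} → u ∈ S → v ∈ S → u ≢ v → Adj G u v

IsCliqueNumber : Graph → ℕ → Set
IsCliqueNumber G ω =
  (∃ λ S → IsClique G S × ∣ S ∣ ≡ ω) × (∀ S → IsClique G S → ∣ S ∣ ≤ ω)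

module Subdivision (H : Graph) (p : ℕ) where

  pairs : List (Fin (order H) × Fin (order H))
  pairs = List.cartesianProduct (List.allFin (order H)) (List.allFin (order H))

  OrderedEdge : Pred (Fin (order H) × Fin (order H)) 0ℓ
  OrderedEdge (u , v) = (u <ᶠ v) × Adj H u v

  orderedEdge? : Unary.Decidable OrderedEdge
  orderedEdge? (u , v) = (u <? v) ×-dec adj? H u v

  -- Each edge is listed once, with its smaller end first.
  edges : List (Fin (order H) × Fin (order H))
  edges = List.filter orderedEdge? pairs

  Edge : Set
  Edge = Fin (List.length edges)

  source target : Edge → Fin (order H)
  source e = proj₁ (List.lookup edges e)
  target e = proj₂ (List.lookup edges e)

  -- The vertices of H, followed by p new vertices for each edge.
  size : ℕ
  size = order H + List.length edges * p

  old : Fin (order H) → Fin size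
  old v = v ↑ˡ (List.length edges * p)

  new : Edge → Fin p → Fin size
  new e i = order H ↑ʳ combine e i

  path : Edge → Vec (Fin size) (2 + p)
  path e = old (source e) ∷ (tabulate (new e) ∷ʳ old (target e))

  Step : Rel (Fin size) 0ℓ
  Step x y = ∃ λ (e : Edge) → ∃ λ (i : Fin (suc p)) →
    x ≡ lookup (path e) (inject₁ i) × y ≡ lookup (path e) (suc i)

  step? : Decidable Step
  step? x y = any? λ e → any? λ i →
    (x ≟ᶠ lookup (path e) (inject₁ i)) ×-dec (y ≟ᶠ lookup (path e) (suc i))

  private
    old≢new : ∀ v e i → old v ≢ new e i
    old≢new v e i eq
      with trans (sym (splitAt-↑ˡ (order H) v (List.length edges * p)))
             (trans (cong (splitAt (order H)) eq)
               (splitAt-↑ʳ (order H) (List.length edges * p) (combine e i)))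
    ... | ()

    new-injective : ∀ e {i j} → new e i ≡ new e j → i ≡ j
    new-injective e {i} {j} eq =
      combine-injectiveʳ e i e j (↑ʳ-injective (order H) _ _ eq)

    source≢target : ∀ e → source e ≢ target e
    source≢target e =
      <⇒≢ (proj₁ (ListAll.lookup (all-filter orderedEdge? pairs) (∈-lookup e)))

    consecutive-distinct :
      ∀ {A : Set} {m} {a b : A} (xs : Vec A m) →
      a ≢ b → All (a ≢_) xs → All (_≢ b) xs → AllPairs _≢_ xs →
      (i : Fin (suc m)) →
      lookup (a ∷ (xs ∷ʳ b)) (inject₁ i) ≢ lookup (a ∷ (xs ∷ʳ b)) (suc i)
    consecutive-distinct []       a≢b _         _          _         zero    = a≢b
    consecutive-distinct (x ∷ xs) _   (a≢x ∷ _) _          _         zero    = a≢x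
    consecutive-distinct (x ∷ xs) _   _         (x≢b ∷ ≢b) (x≢ ∷ ds) (suc i) =
      consecutive-distinct xs x≢b x≢ ≢b ds i

    step-irrefl : ∀ {x} → ¬ Step x x
    step-irrefl (e , i , eq₁ , eq₂) =
      consecutive-distinct (tabulate (new e))
        (source≢target e ∘ ↑ˡ-injective _ _ _)
        (All.tabulate⁺ (old≢new _ e))
        (All.tabulate⁺ (λ j → old≢new _ e j ∘ sym))
        (AllPairs.tabulate⁺ (λ j≢k → j≢k ∘ new-injective e))
        i (trans (sym eq₁) eq₂)

  graph : Graph
  graph = record
    { order      = size
    ; Adj        = λ x y → Step x y ⊎ Step y x
    ; adj?       = λ x y → step? x y ⊎-dec step? y x
    ; adj-sym    = swap
    ; adj-irrefl = λ { refl (inj₁ s) → step-irrefl s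
                     ; refl (inj₂ s) → step-irrefl s }
    }

_⁽_⁾ : Graph → ℕ → Graph
H ⁽ p ⁾ = Subdivision.graph H p

Class : (ℓ : Level) → Set (lsuc 0ℓ ⊔ lsuc ℓ)
Class ℓ = Pred Graph ℓ

record Hereditary {ℓ} (𝒞 : Class ℓ) : Set (lsuc 0ℓ ⊔ ℓ) where
  field
    iso-closed     : ∀ {G H} → G ≅ H → 𝒞 G → 𝒞 H
    induced-closed : ∀ {G} (S : Subset (order G)) → 𝒞 G → 𝒞 (G [ S ])

NowhereDense : ∀ {ℓ} → Class ℓ → Set (lsuc 0ℓ ⊔ ℓ)
NowhereDense 𝒞 = Σ (ℕ → ℕ) λ fω →
  ∀ p H G → 𝒞 G → (H ⁽ p ⁾) IsSubgraphOf G →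
  ∀ ω → IsCliqueNumber H ω → ω ≤ fω p

record HereditaryClassProperty (ℓ ℓ′ : Level) : Set (lsuc 0ℓ ⊔ lsuc ℓ ⊔ lsuc ℓ′) where
  field
    Holds      : Pred (Class ℓ) ℓ′
    hereditary : ∀ {𝒞} → Holds 𝒞 → Hereditary 𝒞
    ⊆-closed   : ∀ {𝒞 𝒟} → Hereditary 𝒞 → 𝒞 ⊆ 𝒟 → Holds 𝒟 → Holds 𝒞

open HereditaryClassProperty public

nowhereDense : ∀ ℓ → HereditaryClassProperty ℓ (lsuc 0ℓ ⊔ ℓ)
nowhereDense ℓ = record
  { Holds      = λ 𝒞 → Hereditary 𝒞 × NowhereDense 𝒞
  ; hereditary = proj₁
  ; ⊆-closed   = λ her 𝒞⊆𝒟 (_ , fω , bound) →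
                   her , fω , λ p H G G∈𝒞 → bound p H G (𝒞⊆𝒟 G∈𝒞)
  }

record IsPartition {n N} (V : Fin N → Subset n) : Set where
  field
    nonempty : ∀ i → Nonempty (V i)
    cover    : ∀ v → ∃! _≡_ λ i → v ∈ V i

HasDecomposition : ∀ {ℓ ℓ′} → HereditaryClassProperty ℓ ℓ′ → (ℕ → ℕ) → ℕ →
                   Class ℓ → Set (lsuc 0ℓ ⊔ lsuc ℓ ⊔ ℓ′)
HasDecomposition Π f p 𝒞 = ∃ λ 𝒟 → Holds Π 𝒟 ×
  (∀ G → 𝒞 G → ∃ λ N → N ≤ f (order G) × ∃ λ (V : Fin N → Subset (order G)) →
    IsPartition V ×
    (∀ (i : Fin p → Fin N) → 𝒟 (G [ ⋃ (List.tabulate (V ∘ i)) ])))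

-- f(n) = n^{o(1)}, i.e. f(n) = n^{g(n)} with g → 0: for every k ≥ 1, eventually
-- |g(n)| ≤ 1/k.  Since f is ℕ-valued, f(n) = n^{g(n)} > 0 forces f(n) ≥ 1 and
-- g(n) ≥ 0, so the condition is f(n) ≥ 1 and f(n) ≤ n^{1/k}.
Subpolynomial : (ℕ → ℕ) → Set
Subpolynomial f = ∀ k .{{_ : NonZero k}} → ∃ λ n₀ → ∀ n → n₀ ≤ n →
  1 ≤ f n × f n ^ k ≤ n

infix 30 _⋆

_⋆ : ∀ {ℓ ℓ′} → HereditaryClassProperty ℓ ℓ′ → Pred (Class ℓ) (lsuc 0ℓ ⊔ lsuc ℓ ⊔ ℓ′)
(Π ⋆) 𝒞 = Hereditary 𝒞 ×
  (∀ p .{{_ : NonZero p}} → ∃ λ f →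
    f Preserves _≤_ ⟶ _≤_ × Subpolynomial f × HasDecomposition Π f p 𝒞)

IsDecompositionHorizon : ∀ {ℓ ℓ′} → HereditaryClassProperty ℓ ℓ′ →
                         Set (lsuc 0ℓ ⊔ lsuc ℓ ⊔ ℓ′)
IsDecompositionHorizon Π = ∀ 𝒞 → (Π ⋆) 𝒞 ⇔ Holds Π 𝒞

-- Every hereditary class has trivial decompositions with one part, so only the
-- inclusion Π⋆ ⊆ Π needs an argument.  Let K_n⁽ᵖ⁾ be a subgraph of a graph in 𝒞;
-- by heredity we may assume it spans the graph, which then has O(n²) vertices and
-- is cut into N = n^o(1) parts with parameter p + 2.  Colour an edge of K_n by
-- the parts met along its subdivided path: there are N^(p+2) colours.
-- Two pigeonhole arguments give a monochromatic complete bipartite graph between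
-- t vertices and as many vertices as K_t has edges.  It contains K_t⁽¹⁾, so
-- K_t⁽²ᵖ⁺¹⁾ lies inside the union of p + 2 parts, and this bounds t.
module Submission where

open import Level using (Level; 0ℓ)
open import Data.Nat using (ℕ; zero; suc; _+_; _*_; _^_; _≤_; _<_; z≤n; s≤s; z<s; NonZero; >-nonZero⁻¹)
open import Data.Nat.Properties as ℕ using (module ≤-Reasoning)
open import Data.Nat.Tactic.RingSolver using (solve-∀)
open import Data.Fin as Fin using (Fin; zero; suc; inject₁; inject≤; fromℕ; opposite; toℕ;
  _↑ˡ_; _↑ʳ_; combine; remQuot; splitAt; join; finToFun; funToFin)
  renaming (_<_ to _<ᶠ_)
open import Data.Fin.Properties as Fin using (any?; <⇒≢; <-cmp; nonZeroIndex)
  renaming (_≟_ to _≟ᶠ_)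
open import Data.Fin.Subset using (Subset; _∈_; ∣_∣; ⋃; ⊤; inside; outside)
open import Data.Fin.Subset.Properties using (x∈p∪q⁺; ∈⊤; ∣⊤∣≡n; ∣p∣≤n)
open import Data.List as List using (List; []; _∷_; length; cartesianProduct)
open import Data.List.Membership.Propositional using () renaming (_∈_ to _∈ˡ_)
open import Data.List.Membership.Propositional.Properties
  using (∈-lookup; ∈-filter⁺; ∈-cartesianProduct⁺; ∈-allFin)
open import Data.List.Properties using (length-filter; length-++; length-map; length-tabulate)
open import Data.List.Relation.Unary.All as All using ()
open import Data.List.Relation.Unary.All.Properties using (all-filter)
open import Data.List.Relation.Unary.AllPairs using (_∷_)
open import Data.List.Relation.Unary.Any as Any using ()
open import Data.List.Relation.Unary.Any.Properties using (lookup-index)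
open import Data.List.Relation.Unary.Unique.Propositional using (Unique)
open import Data.List.Relation.Unary.Unique.Propositional.Properties
  using (filter⁺; cartesianProduct⁺; allFin⁺)
open import Data.Product using (∃; _×_; _,_; proj₁; proj₂; uncurry)
open import Data.Sum using (_⊎_; inj₁; inj₂; [_,_]′)
open import Data.Vec as Vec using (Vec; []; _∷_; _∷ʳ_; _++_; lookup; tabulate; here; there)
open import Data.Vec.Properties
  using (lookup∘tabulate; tabulate∘lookup; tabulate-cong; tabulate-∘; lookup-splitAt; lookup⇒[]=; []=⇒lookup)
open import Function using (_∘_; _on_)
open import Function.Bundles using (mk⇔)
open import Function.Definitions using (Injective)
open import Relation.Binary.Core using (Rel)
open import Relation.Binary.Definitions using (Symmetric; tri<; tri≈; tri>)
open import Relation.Binary.PropositionalEquality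
  using (_≡_; _≢_; _≗_; refl; sym; trans; cong; cong₂; subst; subst₂; ≢-sym)
open import Relation.Nullary using (¬_; yes; no; contradiction)
open import Relation.Nullary.Decidable using (does; dec-true; ¬?)
open import Relation.Unary using (Decidable)
open import Defs

-- Subsets of Fin n

separate : ∀ {n} {P : Fin n → Set} → Decidable P → Subset n
separate P? = tabulate (does ∘ P?)

∈-separate⁺ : ∀ {n} {P : Fin n → Set} (P? : Decidable P) {x} → P x → x ∈ separate P?
∈-separate⁺ P? {x} px =
  lookup⇒[]= x _ (trans (lookup∘tabulate (does ∘ P?) x) (dec-true (P? x) px))

∈-separate⁻ : ∀ {n} {P : Fin n → Set} (P? : Decidable P) {x} → x ∈ separate P? → P x
∈-separate⁻ P? {x} x∈ with P? x | trans (sym (lookup∘tabulate (does ∘ P?) x)) ([]=⇒lookup x∈)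
... | yes px | _  = px
... | no _   | ()

∈-⋃-tabulate : ∀ {n m} (S : Fin m → Subset n) i {x} → x ∈ S i → x ∈ ⋃ (List.tabulate S)
∈-⋃-tabulate S zero    x∈ = x∈p∪q⁺ (inj₁ x∈)
∈-⋃-tabulate S (suc i) x∈ = x∈p∪q⁺ {p = S zero} (inj₂ (∈-⋃-tabulate (S ∘ suc) i x∈))

index : ∀ {n} {S : Subset n} {x} → x ∈ S → Fin ∣ S ∣
index {S = inside  ∷ S} here       = zero
index {S = inside  ∷ S} (there x∈) = suc (index x∈)
index {S = outside ∷ S} (there x∈) = index x∈

elements-index : ∀ {n} {S : Subset n} {x} (x∈ : x ∈ S) → elements S (index x∈) ≡ x
elements-index {S = inside  ∷ S} here       = refl
elements-index {S = inside  ∷ S} (there x∈) = cong suc (elements-index x∈)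
elements-index {S = outside ∷ S} (there x∈) = cong suc (elements-index x∈)

elements-∈ : ∀ {n} (S : Subset n) i → elements S i ∈ S
elements-∈ (inside  ∷ S) zero    = here
elements-∈ (inside  ∷ S) (suc i) = there (elements-∈ S i)
elements-∈ (outside ∷ S) i       = there (elements-∈ S i)

elements-mono-< : ∀ {n} (S : Subset n) {i j} → i <ᶠ j → elements S i <ᶠ elements S j
elements-mono-< (inside  ∷ S) {zero}  {suc j} _         = z<s
elements-mono-< (inside  ∷ S) {suc i} {suc j} (s≤s i<j) = s≤s (elements-mono-< S i<j)
elements-mono-< (outside ∷ S)                 i<j       = s≤s (elements-mono-< S i<j)

strictMono⇒injective : ∀ {m n} {f : Fin m → Fin n} →
  (∀ {i j} → i <ᶠ j → f i <ᶠ f j) → Injective _≡_ _≡_ f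
strictMono⇒injective mono {i} {j} eq with <-cmp i j
... | tri< i<j _ _ = contradiction eq (<⇒≢ (mono i<j))
... | tri≈ _ i≡j _ = i≡j
... | tri> _ _ j<i = contradiction (sym eq) (<⇒≢ (mono j<i))

elements-injective : ∀ {n} (S : Subset n) → Injective _≡_ _≡_ (elements S)
elements-injective S = strictMono⇒injective (elements-mono-< S)

index-injective : ∀ {n} {S : Subset n} {x y} (x∈ : x ∈ S) (y∈ : y ∈ S) →
  index x∈ ≡ index y∈ → x ≡ y
index-injective {S = S} x∈ y∈ eq =
  trans (sym (elements-index x∈)) (trans (cong (elements S) eq) (elements-index y∈))

-- Pigeonhole principles

fibre : ∀ {r k} → (Fin r → Fin k) → Fin k → Subset r
fibre f c = separate (λ x → f x ≟ᶠ c)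

-- Opaque because unification would otherwise unfold the pigeonhole searches.
opaque
  largeFibre : ∀ k s {r} → k * s < r → (f : Fin r → Fin k) →
    ∃ λ c → ∃ λ (g : Fin (suc s) → Fin r) → Injective _≡_ _≡_ g × (∀ i → f (g i) ≡ c)
  largeFibre k s {r} ks<r f with any? (λ c → suc s ℕ.≤? ∣ fibre f c ∣)
  ... | yes (c , s<) =
    c , (λ i → elements (fibre f c) (inject≤ i s<)) ,
    (λ eq → Fin.inject≤-injective s< s< _ _ (elements-injective (fibre f c) eq)) ,
    (λ i → ∈-separate⁻ (λ x → f x ≟ᶠ c) (elements-∈ (fibre f c) (inject≤ i s<)))
  -- If every fibre has at most s elements, a point is determined by its colour and its rank within
  -- its fibre, which gives an injection into k * s values.
  ... | no none = contradiction (Fin.injective⇒≤ code-injective) (ℕ.<⇒≱ ks<r)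
    where
    self∈ : ∀ x → x ∈ fibre f (f x)
    self∈ x = ∈-separate⁺ (λ y → f y ≟ᶠ f x) refl

    small : ∀ c → ∣ fibre f c ∣ ≤ s
    small c = ℕ.≮⇒≥ (λ s< → none (c , s<))

    rank : ∀ {c} x → x ∈ fibre f c → Fin s
    rank {c} x x∈ = inject≤ (index x∈) (small c)

    -- In `code-injective` the colours `f x` and `f y` are only provably equal; keeping c and c′ as
    -- variables allows their equation to be matched.
    rank-injective : ∀ {c c′ x y} (x∈ : x ∈ fibre f c) (y∈ : y ∈ fibre f c′) → c ≡ c′ →
      rank x x∈ ≡ rank y y∈ → x ≡ y
    rank-injective {c} x∈ y∈ refl eq =
      index-injective x∈ y∈ (Fin.inject≤-injective (small c) (small c) _ _ eq)

    code : Fin r → Fin (k * s)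
    code x = combine (f x) (rank x (self∈ x))

    code-injective : Injective _≡_ _≡_ code
    code-injective {x} {y} eq =
      rank-injective (self∈ x) (self∈ y)
        (Fin.combine-injectiveˡ (f x) (rank x (self∈ x)) (f y) (rank y (self∈ y)) eq)
        (Fin.combine-injectiveʳ (f x) (rank x (self∈ x)) (f y) (rank y (self∈ y)) eq)

opaque
  -- A coloured form of the Kővári-Sós-Turán double count. The factor m ^ suc a counts tuples of
  -- leaves rather than sets, because tuples are what `funToFin` encodes.
  monochromaticBiclique : ∀ M a s {m r} → M * a < m → (M * m ^ suc a) * s < r →
    (χ : Fin m → Fin r → Fin M) →
    ∃ λ c → ∃ λ (α : Fin (suc a) → Fin m) → ∃ λ (β : Fin (suc s) → Fin r) →
      Injective _≡_ _≡_ α × Injective _≡_ _≡_ β × (∀ i j → χ (α i) (β j) ≡ c)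
  monochromaticBiclique M a s {m} {r} Ma<m Mm^s<r χ = c , α , β , α-inj , β-inj , mono
    where
    starAt : ∀ y → ∃ λ c → ∃ λ (g : Fin (suc a) → Fin m) →
      Injective _≡_ _≡_ g × (∀ i → χ (g i) y ≡ c)
    starAt y = largeFibre M a Ma<m (λ x → χ x y)

    colour : Fin r → Fin M
    colour y = proj₁ (starAt y)

    leaf : Fin r → Fin (suc a) → Fin m
    leaf y = proj₁ (proj₂ (starAt y))

    -- Every y sees a star of one colour; it is one of M * m ^ suc a possible choices
    -- of a colour and of suc a leaves, so some star is seen by many y.
    code : Fin r → Fin (M * m ^ suc a)
    code y = combine (colour y) (funToFin (leaf y))

    repeated : ∃ λ d → ∃ λ (β : Fin (suc s) → Fin r) → Injective _≡_ _≡_ β × (∀ j → code (β j) ≡ d)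
    repeated = largeFibre (M * m ^ suc a) s Mm^s<r code

    d : Fin (M * m ^ suc a)
    d = proj₁ repeated

    β : Fin (suc s) → Fin r
    β = proj₁ (proj₂ repeated)

    β-inj : Injective _≡_ _≡_ β
    β-inj = proj₁ (proj₂ (proj₂ repeated))

    code-β : ∀ j → code (β j) ≡ d
    code-β = proj₂ (proj₂ (proj₂ repeated))

    -- Colour and leaves are read off the common code d, so they do not depend on any j; `decode`
    -- then identifies them with those of every `β j`.
    c : Fin M
    c = proj₁ (remQuot {M} (m ^ suc a) d)

    α : Fin (suc a) → Fin m
    α = finToFun {m} {suc a} (proj₂ (remQuot {M} (m ^ suc a) d))

    decode : ∀ j → (colour (β j) , funToFin (leaf (β j))) ≡ remQuot {M} (m ^ suc a) d
    decode j = trans (sym (Fin.remQuot-combine (colour (β j)) (funToFin (leaf (β j)))))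
                     (cong (remQuot {M} (m ^ suc a)) (code-β j))

    leaf-β : ∀ j i → leaf (β j) i ≡ α i
    leaf-β j i = trans (sym (Fin.finToFun-funToFin (leaf (β j)) i))
                       (cong (λ z → finToFun {m} {suc a} z i) (cong proj₂ (decode j)))

    α-inj : Injective _≡_ _≡_ α
    -- Distinctness of the leaves is inherited from the star seen by `β zero`, which exists because
    -- the right side has suc s vertices.
    α-inj {i} {i′} eq = proj₁ (proj₂ (proj₂ (starAt (β zero))))
      (trans (leaf-β zero i) (trans eq (sym (leaf-β zero i′))))

    mono : ∀ i j → χ (α i) (β j) ≡ c
    mono i j = trans (cong (λ x → χ x (β j)) (sym (leaf-β j i)))
      (trans (proj₂ (proj₂ (proj₂ (starAt (β j)))) i) (cong proj₁ (decode j)))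

-- Walks

module _ {A : Set} (R : Rel A 0ℓ) where

  -- The vector holds the inner vertices only and the ends are separate, so an unsubdivided edge (p
  -- = 0) is no special case.
  Walk : ∀ {m} → A → Vec A m → A → Set
  Walk a []       b = R a b
  Walk a (x ∷ xs) b = R a x × Walk x xs b

  walk-++ : ∀ {m n a c b} (xs : Vec A m) {ys : Vec A n} →
    Walk a xs c → Walk c ys b → Walk a (xs ++ c ∷ ys) b
  walk-++ []       r       w = r , w
  walk-++ (x ∷ xs) (r , v) w = r , walk-++ xs v w

  walk⇒step : ∀ {m a b} (xs : Vec A m) → Walk a xs b → (i : Fin (suc m)) →
    R (lookup (a ∷ (xs ∷ʳ b)) (inject₁ i)) (lookup (a ∷ (xs ∷ʳ b)) (suc i))
  walk⇒step []       r       zero    = r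
  walk⇒step (x ∷ xs) (r , _) zero    = r
  walk⇒step (x ∷ xs) (_ , w) (suc i) = walk⇒step xs w i

  step⇒walk : ∀ {m a b} (xs : Vec A m) →
    (∀ (i : Fin (suc m)) → R (lookup (a ∷ (xs ∷ʳ b)) (inject₁ i)) (lookup (a ∷ (xs ∷ʳ b)) (suc i))) →
    Walk a xs b
  step⇒walk []       step = step zero
  step⇒walk (x ∷ xs) step = step zero , step⇒walk xs (step ∘ suc)

  -- Prepares reversal: `opposite` sends zero to `fromℕ n` and suc i to `inject₁ (opposite i)`, so
  -- the reversed walk starts with the old last step.
  walk-initLast : ∀ {n a b} (f : Fin (suc n) → A) → Walk a (tabulate f) b →
    Walk a (tabulate (f ∘ inject₁)) (f (fromℕ n)) × R (f (fromℕ n)) b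
  walk-initLast {zero}  f (r , r′) = r , r′
  walk-initLast {suc n} f (r , w)  =
    let w′ , r′ = walk-initLast (f ∘ suc) w in (r , w′) , r′

  walk-opposite : Symmetric R → ∀ {n a b} (f : Fin n → A) →
    Walk a (tabulate f) b → Walk b (tabulate (f ∘ opposite)) a
  walk-opposite R-sym {zero}  f r = R-sym r
  walk-opposite R-sym {suc n} f w =
    let w′ , r = walk-initLast f w in R-sym r , walk-opposite R-sym (f ∘ inject₁) w′

walk-on : ∀ {A B : Set} {R : Rel B 0ℓ} (f : A → B) {m a b} (xs : Vec A m) →
  Walk R (f a) (Vec.map f xs) (f b) → Walk (R on f) a xs b
walk-on f []       r       = r
walk-on f (x ∷ xs) (r , w) = r , walk-on f xs w

-- Edges of a graph

lookup-injective : ∀ {A : Set} {xs : List A} → Unique xs → Injective _≡_ _≡_ (List.lookup xs)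
lookup-injective {xs = x ∷ xs} u         {zero}  {zero}  eq = refl
lookup-injective {xs = x ∷ xs} (x∉ ∷ _)  {zero}  {suc j} eq =
  contradiction eq (All.lookup x∉ (∈-lookup j))
lookup-injective {xs = x ∷ xs} (x∉ ∷ _)  {suc i} {zero}  eq =
  contradiction (sym eq) (All.lookup x∉ (∈-lookup i))
lookup-injective {xs = x ∷ xs} (_ ∷ u)   {suc i} {suc j} eq = cong suc (lookup-injective u eq)

length-cartesianProduct : ∀ {A B : Set} (xs : List A) (ys : List B) →
  length (cartesianProduct xs ys) ≡ length xs * length ys
length-cartesianProduct []       ys = refl
length-cartesianProduct (x ∷ xs) ys =
  trans (length-++ (List.map (x ,_) ys))
        (cong₂ _+_ (length-map (x ,_) ys) (length-cartesianProduct xs ys))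

-- Subdivisions and maps out of them

module SubdivisionProperties (H : Graph) (p : ℕ) where
  open Subdivision H p

  source<target : ∀ e → source e <ᶠ target e
  source<target e = proj₁ (All.lookup (all-filter orderedEdge? pairs) (∈-lookup e))

  source-target-adj : ∀ e → Adj H (source e) (target e)
  source-target-adj e = proj₂ (All.lookup (all-filter orderedEdge? pairs) (∈-lookup e))

  -- The edge list has no repetitions, being filtered from a product of lists without repetitions.
  edge-≡ : ∀ {e e′} → source e ≡ source e′ → target e ≡ target e′ → e ≡ e′
  edge-≡ s t = lookup-injective
    (filter⁺ orderedEdge? (cartesianProduct⁺ (allFin⁺ (order H)) (allFin⁺ (order H))))
    (cong₂ _,_ s t)

  private
    ∈-edges : ∀ {u v} → u <ᶠ v → Adj H u v → (u , v) ∈ˡ edges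
    ∈-edges {u} {v} u<v uv =
      ∈-filter⁺ orderedEdge? (∈-cartesianProduct⁺ (∈-allFin u) (∈-allFin v)) (u<v , uv)

  edge : ∀ {u v} → u <ᶠ v → Adj H u v → Edge
  edge u<v uv = Any.index (∈-edges u<v uv)

  source-edge : ∀ {u v} (u<v : u <ᶠ v) (uv : Adj H u v) → source (edge u<v uv) ≡ u
  source-edge u<v uv = cong proj₁ (sym (lookup-index (∈-edges u<v uv)))

  target-edge : ∀ {u v} (u<v : u <ᶠ v) (uv : Adj H u v) → target (edge u<v uv) ≡ v
  target-edge u<v uv = cong proj₂ (sym (lookup-index (∈-edges u<v uv)))

  old-injective : Injective _≡_ _≡_ old
  old-injective = Fin.↑ˡ-injective _ _ _

  new-injective : ∀ {e e′ i i′} → new e i ≡ new e′ i′ → e ≡ e′ × i ≡ i′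
  new-injective {e} {e′} {i} {i′} eq =
    Fin.combine-injectiveˡ e i e′ i′ combine≡ , Fin.combine-injectiveʳ e i e′ i′ combine≡
    where combine≡ = Fin.↑ʳ-injective (order H) _ _ eq

  old≢new : ∀ {v e i} → old v ≢ new e i
  old≢new {v} {e} {i} eq
    with trans (sym (Fin.splitAt-↑ˡ (order H) v (length edges * p)))
           (trans (cong (splitAt (order H)) eq) (Fin.splitAt-↑ʳ (order H) _ (combine e i)))
  ... | ()

  -- Allows case analysis on the kind of a vertex in place of arithmetic on its number.
  data View : Fin size → Set where
    isOld : ∀ v → View (old v)
    isNew : ∀ e i → View (new e i)

  view : ∀ x → View x
  view x = subst View (Fin.join-splitAt (order H) _ x) (view-join (splitAt (order H) x))
    where
    view-join : ∀ y → View (join (order H) (length edges * p) y)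
    view-join (inj₁ v) = isOld v
    view-join (inj₂ z) = subst (View ∘ (order H ↑ʳ_)) (Fin.combine-remQuot {length edges} p z)
                           (uncurry isNew (remQuot {length edges} p z))

  pathWalk : ∀ e → Walk (Adj graph) (old (source e)) (tabulate (new e)) (old (target e))
  pathWalk e = step⇒walk _ (tabulate (new e)) (λ i → inj₁ (e , i , refl , refl))

  -- Both ends come first, unlike in `path`: the parts met by a path are recorded vertex by vertex,
  -- and the order along the path is irrelevant there.
  pathVertex : Edge → Fin (2 + p) → Fin size
  pathVertex e zero          = old (source e)
  pathVertex e (suc zero)    = old (target e)
  pathVertex e (suc (suc k)) = new e k

  -- A quadratic bound is enough: a subpolynomial function of the size is then subpolynomial in the
  -- order of H.
  size-bound : 1 ≤ order H → size ≤ suc p * (order H * order H)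
  size-bound 1≤n = begin
    n + length edges * p       ≤⟨ ℕ.+-mono-≤ n≤n*n (ℕ.*-monoˡ-≤ p edges≤) ⟩
    n * n + n * n * p          ≡⟨ cong (n * n +_) (ℕ.*-comm (n * n) p) ⟩
    suc p * (n * n)            ∎
    where
    open ≤-Reasoning
    n = order H
    n≤n*n : n ≤ n * n
    n≤n*n = subst (_≤ n * n) (ℕ.*-identityʳ n) (ℕ.*-monoʳ-≤ n 1≤n)
    edges≤ : length edges ≤ n * n
    edges≤ = begin
      length edges   ≤⟨ length-filter orderedEdge? pairs ⟩
      length pairs   ≡⟨ length-cartesianProduct (List.allFin n) (List.allFin n) ⟩
      length (List.allFin n) * length (List.allFin n)
                     ≡⟨ cong₂ _*_ (length-tabulate {n = n} (λ i → i)) (length-tabulate {n = n} (λ i → i)) ⟩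
      n * n          ∎

  -- A map out of the subdivision is prescribed on old and on new vertices. The lemmas reduce being
  -- an embedding to separate injectivity conditions and one walk per edge.
  module Glue {A : Set} (f : Fin (order H) → A) (g : Edge → Fin p → A) where

    glue : Fin size → A
    glue x = [ f , uncurry g ∘ remQuot {length edges} p ]′ (splitAt (order H) x)

    glue-old : ∀ v → glue (old v) ≡ f v
    glue-old v = cong [ f , uncurry g ∘ remQuot {length edges} p ]′
      (Fin.splitAt-↑ˡ (order H) v (length edges * p))

    glue-new : ∀ e i → glue (new e i) ≡ g e i
    glue-new e i = trans
      (cong [ f , uncurry g ∘ remQuot {length edges} p ]′ (Fin.splitAt-↑ʳ (order H) _ (combine e i)))
      (cong (uncurry g) (Fin.remQuot-combine e i))

    glue-elim : (P : A → Set) → (∀ v → P (f v)) → (∀ e i → P (g e i)) → ∀ x → P (glue x)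
    glue-elim P Pf Pg x with view x
    ... | isOld v   = subst P (sym (glue-old v)) (Pf v)
    ... | isNew e i = subst P (sym (glue-new e i)) (Pg e i)

    glue-injective : Injective _≡_ _≡_ f →
      (∀ {e e′ i i′} → g e i ≡ g e′ i′ → e ≡ e′ × i ≡ i′) →
      (∀ {v e i} → f v ≢ g e i) → Injective _≡_ _≡_ glue
    glue-injective f-inj g-inj f≢g {x} {y} eq with view x | view y
    ... | isOld v   | isOld w    = cong old (f-inj (trans (sym (glue-old v)) (trans eq (glue-old w))))
    ... | isOld v   | isNew e i  = contradiction (trans (sym (glue-old v)) (trans eq (glue-new e i))) f≢g
    ... | isNew e i | isOld v    =
      contradiction (trans (sym (glue-old v)) (trans (sym eq) (glue-new e i))) f≢g
    ... | isNew e i | isNew e′ j =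
      let e≡ , i≡ = g-inj (trans (sym (glue-new e i)) (trans eq (glue-new e′ j))) in cong₂ new e≡ i≡

    glue-adj : {R : Rel A 0ℓ} → Symmetric R →
      (∀ e → Walk R (f (source e)) (tabulate (g e)) (f (target e))) →
      ∀ {x y} → Adj graph x y → R (glue x) (glue y)
    glue-adj {R} R-sym walks = λ { (inj₁ s) → step s ; (inj₂ s) → R-sym (step s) }
      where
      map-glue : ∀ e → Vec.map glue (tabulate (new e)) ≡ tabulate (g e)
      map-glue e = trans (sym (tabulate-∘ glue (new e))) (tabulate-cong (glue-new e))

      walkAlong : ∀ e → Walk (R on glue) (old (source e)) (tabulate (new e)) (old (target e))
      walkAlong e = walk-on {R = R} glue (tabulate (new e))
        (subst₂ (λ a b → Walk R a (Vec.map glue (tabulate (new e))) b)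
          (sym (glue-old (source e))) (sym (glue-old (target e)))
          (subst (λ xs → Walk R (f (source e)) xs (f (target e))) (sym (map-glue e)) (walks e)))

      step : ∀ {x y} → Step x y → R (glue x) (glue y)
      step (e , i , refl , refl) = walk⇒step _ (tabulate (new e)) (walkAlong e) i

-- Subgraphs

IsSubgraphOf-trans : ∀ {G H K} → G IsSubgraphOf H → H IsSubgraphOf K → G IsSubgraphOf K
IsSubgraphOf-trans G⊆H H⊆K = record
  { embed     = embed H⊆K ∘ embed G⊆H
  ; injective = injective G⊆H ∘ injective H⊆K
  ; adj-mono  = adj-mono H⊆K ∘ adj-mono G⊆H
  }
  where open _IsSubgraphOf_

module _ {G H : Graph} (G⊆H : G IsSubgraphOf H) where
  open _IsSubgraphOf_ G⊆H

  subgraph-[] : (S : Subset (order H)) → (∀ x → embed x ∈ S) → G IsSubgraphOf (H [ S ])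
  subgraph-[] S embed∈ = record
    { embed     = index ∘ embed∈
    ; injective = λ {x} {y} eq → injective (index-injective (embed∈ x) (embed∈ y) eq)
    ; adj-mono  = λ {x} {y} xy → subst₂ (Adj H)
        (sym (elements-index (embed∈ x))) (sym (elements-index (embed∈ y))) (adj-mono xy)
    }

  subgraph⇒order≤ : order G ≤ order H
  subgraph⇒order≤ = Fin.injective⇒≤ injective

  image : Subset (order H)
  image = separate (λ y → any? (λ x → embed x ≟ᶠ y))

  embed∈image : ∀ x → embed x ∈ image
  embed∈image x = ∈-separate⁺ (λ y → any? (λ x → embed x ≟ᶠ y)) (x , refl)

  ∣image∣≤ : ∣ image ∣ ≤ order G
  ∣image∣≤ = Fin.injective⇒≤ {f = proj₁ ∘ preimage} (λ {i} {j} eq → elements-injective image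
    (trans (sym (proj₂ (preimage i))) (trans (cong embed eq) (proj₂ (preimage j)))))
    where
    preimage : ∀ i → ∃ λ x → embed x ≡ elements image i
    preimage i = ∈-separate⁻ (λ y → any? (λ x → embed x ≟ᶠ y)) (elements-∈ image i)

-- Each edge is listed with its smaller end first, so an increasing f sends source to source and
-- target to target, and no path has to be reversed.
subdivision-mono : ∀ {G H} p (f : Fin (order G) → Fin (order H)) →
  (∀ {u v} → u <ᶠ v → f u <ᶠ f v) → (∀ {u v} → Adj G u v → Adj H (f u) (f v)) →
  (G ⁽ p ⁾) IsSubgraphOf (H ⁽ p ⁾)
subdivision-mono {G} {H} p f f-mono f-adj = record
  { embed     = glue
  ; injective = glue-injective (f-injective ∘ B.old-injective) new-edge-injective B.old≢new
  ; adj-mono  = glue-adj (adj-sym (H ⁽ p ⁾)) walks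
  }
  where
  module S = Subdivision G p
  module T = Subdivision H p
  module A = SubdivisionProperties G p
  module B = SubdivisionProperties H p

  f-injective : Injective _≡_ _≡_ f
  f-injective = strictMono⇒injective f-mono

  mapEdge : S.Edge → T.Edge
  mapEdge e = B.edge (f-mono (A.source<target e)) (f-adj (A.source-target-adj e))

  source-mapEdge : ∀ e → T.source (mapEdge e) ≡ f (S.source e)
  source-mapEdge e = B.source-edge (f-mono (A.source<target e)) (f-adj (A.source-target-adj e))

  target-mapEdge : ∀ e → T.target (mapEdge e) ≡ f (S.target e)
  target-mapEdge e = B.target-edge (f-mono (A.source<target e)) (f-adj (A.source-target-adj e))

  mapEdge-injective : Injective _≡_ _≡_ mapEdge
  mapEdge-injective {e} {e′} eq = A.edge-≡
    (f-injective (trans (sym (source-mapEdge e)) (trans (cong T.source eq) (source-mapEdge e′))))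
    (f-injective (trans (sym (target-mapEdge e)) (trans (cong T.target eq) (target-mapEdge e′))))

  open A.Glue (T.old ∘ f) (T.new ∘ mapEdge)

  new-edge-injective : ∀ {e e′ i i′} →
    T.new (mapEdge e) i ≡ T.new (mapEdge e′) i′ → e ≡ e′ × i ≡ i′
  new-edge-injective eq = let e≡ , i≡ = B.new-injective eq in mapEdge-injective e≡ , i≡

  walks : ∀ e → Walk (Adj (H ⁽ p ⁾)) (T.old (f (S.source e))) (tabulate (T.new (mapEdge e)))
                     (T.old (f (S.target e)))
  walks e = subst₂ (λ u v → Walk (Adj (H ⁽ p ⁾)) (T.old u) (tabulate (T.new (mapEdge e))) (T.old v))
    (source-mapEdge e) (target-mapEdge e) (B.pathWalk (mapEdge e))

-- Complete graphs

complete : ℕ → Graph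
complete n = record
  { order      = n
  ; Adj        = _≢_
  ; adj?       = λ u v → ¬? (u ≟ᶠ v)
  ; adj-sym    = ≢-sym
  ; adj-irrefl = λ u≡v u≢v → u≢v u≡v
  }

cliqueNumber-complete : ∀ n → IsCliqueNumber (complete n) n
cliqueNumber-complete n = (⊤ , (λ _ _ u≢v → u≢v) , ∣⊤∣≡n n) , (λ S _ → ∣p∣≤n S)

clique⇒completeSubdivision : ∀ {H} p {S} → IsClique H S →
  (complete ∣ S ∣ ⁽ p ⁾) IsSubgraphOf (H ⁽ p ⁾)
clique⇒completeSubdivision {H} p {S} clique =
  subdivision-mono {complete ∣ S ∣} {H} p (elements S) (elements-mono-< S)
    (λ {u} {v} u≢v → clique (elements-∈ S u) (elements-∈ S v) (u≢v ∘ elements-injective S))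

-- The edge e of the complete graph on α becomes the path from α (source e) to
-- α (target e) through β (suc e), so that one subdivided biclique contains it.
-- The vertex β zero serves to join every α i to something even if there is no e.
module SubdividedBiclique {n t p : ℕ}
  (α : Fin t → Fin n) (β : Fin (suc (length (Subdivision.edges (complete t) (p + suc p)))) → Fin n)
  (α-injective : Injective _≡_ _≡_ α) (β-injective : Injective _≡_ _≡_ β)
  (α<β : ∀ i j → α i <ᶠ β j)
  where

  private
    module S = Subdivision (complete t) (p + suc p)
    module T = Subdivision (complete n) p
    module A = SubdivisionProperties (complete t) (p + suc p)
    module B = SubdivisionProperties (complete n) p

    _⟶_ : Fin t → Fin (suc (length S.edges)) → T.Edge
    i ⟶ j = B.edge (α<β i j) (<⇒≢ (α<β i j))

    source-⟶ : ∀ i j → T.source (i ⟶ j) ≡ α i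
    source-⟶ i j = B.source-edge (α<β i j) (<⇒≢ (α<β i j))

    target-⟶ : ∀ i j → T.target (i ⟶ j) ≡ β j
    target-⟶ i j = B.target-edge (α<β i j) (<⇒≢ (α<β i j))

    ⟶-injective : ∀ {i i′ j j′} → i ⟶ j ≡ i′ ⟶ j′ → i ≡ i′ × j ≡ j′
    ⟶-injective {i} {i′} {j} {j′} eq =
      α-injective (trans (sym (source-⟶ i j)) (trans (cong T.source eq) (source-⟶ i′ j′))) ,
      β-injective (trans (sym (target-⟶ i j)) (trans (cong T.target eq) (target-⟶ i′ j′)))

    -- The p + suc p inner vertices are p vertices leading to β (suc e), that vertex itself, and p
    -- vertices leading away. The last p run against the direction of their edge, hence `opposite`.
    inner′ : S.Edge → Fin p ⊎ Fin (suc p) → Fin T.size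
    inner′ e (inj₁ i)       = T.new (S.source e ⟶ suc e) i
    inner′ e (inj₂ zero)    = T.old (β (suc e))
    inner′ e (inj₂ (suc i)) = T.new (S.target e ⟶ suc e) (opposite i)

    inner : S.Edge → Fin (p + suc p) → Fin T.size
    inner e = inner′ e ∘ splitAt p

    opposite-injective : ∀ {i j : Fin p} → opposite i ≡ opposite j → i ≡ j
    opposite-injective {i} {j} eq = trans (sym (Fin.opposite-involutive i))
      (trans (cong opposite eq) (Fin.opposite-involutive j))

    -- The end β (suc e) determines e, so equality would force e and e′ to coincide and the two ends
    -- of one edge to be equal.
    source⟶≢target⟶ : ∀ {e e′} → S.source e ⟶ suc e ≢ S.target e′ ⟶ suc e′
    source⟶≢target⟶ eq with ⟶-injective eq
    ... | s≡t , refl = <⇒≢ (A.source<target _) s≡t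

    inner′-injective : ∀ {e e′} x y → inner′ e x ≡ inner′ e′ y → e ≡ e′ × x ≡ y
    inner′-injective (inj₁ i) (inj₁ j) eq =
      let e≡ , i≡ = B.new-injective eq in Fin.suc-injective (proj₂ (⟶-injective e≡)) , cong inj₁ i≡
    inner′-injective (inj₁ i) (inj₂ zero) eq = contradiction (sym eq) B.old≢new
    inner′-injective (inj₁ i) (inj₂ (suc j)) eq =
      contradiction (proj₁ (B.new-injective eq)) source⟶≢target⟶
    inner′-injective (inj₂ zero) (inj₁ j) eq = contradiction eq B.old≢new
    inner′-injective (inj₂ zero) (inj₂ zero) eq = Fin.suc-injective (β-injective (B.old-injective eq)) , refl
    inner′-injective (inj₂ zero) (inj₂ (suc j)) eq = contradiction eq B.old≢new
    inner′-injective (inj₂ (suc i)) (inj₁ j) eq =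
      contradiction (sym (proj₁ (B.new-injective eq))) source⟶≢target⟶
    inner′-injective (inj₂ (suc i)) (inj₂ zero) eq = contradiction (sym eq) B.old≢new
    inner′-injective (inj₂ (suc i)) (inj₂ (suc j)) eq =
      let e≡ , i≡ = B.new-injective eq
      in Fin.suc-injective (proj₂ (⟶-injective e≡)) , cong (inj₂ ∘ suc) (opposite-injective i≡)

    inner-injective : ∀ {e e′ i i′} → inner e i ≡ inner e′ i′ → e ≡ e′ × i ≡ i′
    inner-injective {i = i} {i′} eq =
      let e≡ , s≡ = inner′-injective (splitAt p i) (splitAt p i′) eq
      in e≡ , trans (sym (Fin.join-splitAt p (suc p) i))
                    (trans (cong (join p (suc p)) s≡) (Fin.join-splitAt p (suc p) i′))

    old-α≢inner : ∀ {v e i} → T.old (α v) ≢ inner e i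
    old-α≢inner {v} {e} {i} eq with splitAt p i
    ... | inj₁ _       = B.old≢new eq
    ... | inj₂ zero    = <⇒≢ (α<β v (suc e)) (B.old-injective eq)
    ... | inj₂ (suc _) = B.old≢new eq

    firstHalf : S.Edge → Vec (Fin T.size) p
    firstHalf e = tabulate (T.new (S.source e ⟶ suc e))

    secondHalf : S.Edge → Vec (Fin T.size) p
    secondHalf e = tabulate (T.new (S.target e ⟶ suc e) ∘ opposite)

    tabulate-inner : ∀ e → firstHalf e ++ T.old (β (suc e)) ∷ secondHalf e ≡ tabulate (inner e)
    tabulate-inner e = trans (sym (tabulate∘lookup _)) (tabulate-cong (λ i →
      trans (lookup-splitAt p (firstHalf e) (T.old (β (suc e)) ∷ secondHalf e) i) (cases (splitAt p i))))
      where
      cases : ∀ x → [ lookup (firstHalf e) , lookup (T.old (β (suc e)) ∷ secondHalf e) ]′ x ≡ inner′ e x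
      cases (inj₁ i)       = lookup∘tabulate _ i
      cases (inj₂ zero)    = refl
      cases (inj₂ (suc i)) = lookup∘tabulate _ i

    ⟶-walk : ∀ i j → Walk (Adj T.graph) (T.old (α i)) (tabulate (T.new (i ⟶ j))) (T.old (β j))
    ⟶-walk i j = subst₂ (λ u v → Walk (Adj T.graph) (T.old u) (tabulate (T.new (i ⟶ j))) (T.old v))
      (source-⟶ i j) (target-⟶ i j) (B.pathWalk (i ⟶ j))

    walks : ∀ e → Walk (Adj T.graph) (T.old (α (S.source e))) (tabulate (inner e)) (T.old (α (S.target e)))
    walks e = subst (λ xs → Walk (Adj T.graph) (T.old (α (S.source e))) xs (T.old (α (S.target e))))
      (tabulate-inner e)
      (walk-++ (Adj T.graph) (firstHalf e) (⟶-walk (S.source e) (suc e))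
        (walk-opposite (Adj T.graph) (adj-sym T.graph) (T.new (S.target e ⟶ suc e))
          (⟶-walk (S.target e) (suc e))))

    open A.Glue (T.old ∘ α) inner

  subgraph : S.graph IsSubgraphOf T.graph
  subgraph = record
    { embed     = glue
    ; injective = glue-injective (α-injective ∘ B.old-injective) inner-injective
                    (λ {v} {e} {i} → old-α≢inner {v} {e} {i})
    ; adj-mono  = glue-adj (adj-sym T.graph) walks
    }

  -- Transfers membership in a union of parts from the paths of the biclique to the whole embedded
  -- subdivision, all of whose vertices lie on those paths.
  embed-elim : (P : Fin T.size → Set) →
    (∀ i j k → P (B.pathVertex (B.edge (α<β i j) (<⇒≢ (α<β i j))) k)) →
    ∀ x → P (_IsSubgraphOf_.embed subgraph x)
  embed-elim P Ppath = glue-elim P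
    (λ i → subst (P ∘ T.old) (source-⟶ i zero) (Ppath i zero zero))
    (λ e i → Pinner e (splitAt p i))
    where
    Pinner : ∀ e x → P (inner′ e x)
    Pinner e (inj₁ i)       = Ppath (S.source e) (suc e) (suc (suc i))
    Pinner e (inj₂ zero)    =
      subst (P ∘ T.old) (target-⟶ (S.source e) (suc e)) (Ppath (S.source e) (suc e) (suc zero))
    Pinner e (inj₂ (suc i)) = Ppath (S.target e) (suc e) (suc (suc (opposite i)))

-- Monochromatic bicliques in complete graphs

bicliqueOrder : ℕ → ℕ → ℕ → ℕ
bicliqueOrder M a s = suc (M * a) + suc (M * suc (M * a) ^ suc a * s)

module _ {n M : ℕ} (a s : ℕ) (large : bicliqueOrder M a s ≤ n) where
  private
    m r : ℕ
    -- The least sizes satisfying the two strict inequalities of `monochromaticBiclique`, which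
    -- therefore hold by reflexivity.
    m = suc (M * a)
    r = suc (M * m ^ suc a * s)

    -- The sides are consecutive intervals of vertices, so every edge between them is oriented from
    -- left to right.
    L : Fin m → Fin n
    L x = inject≤ (x ↑ˡ r) large

    R : Fin r → Fin n
    R y = inject≤ (m ↑ʳ y) large

    L<R : ∀ x y → L x <ᶠ R y
    L<R x y = begin-strict
      toℕ (L x)          ≡⟨ Fin.toℕ-inject≤ (x ↑ˡ r) large ⟩
      toℕ (x ↑ˡ r)       ≡⟨ Fin.toℕ-↑ˡ x r ⟩
      toℕ x              <⟨ Fin.toℕ<n x ⟩
      m                  ≤⟨ ℕ.m≤m+n m (toℕ y) ⟩
      m + toℕ y          ≡⟨ sym (Fin.toℕ-↑ʳ m y) ⟩
      toℕ (m ↑ʳ y)       ≡⟨ sym (Fin.toℕ-inject≤ (m ↑ʳ y) large) ⟩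
      toℕ (R y)          ∎
      where open ≤-Reasoning

    L-injective : Injective _≡_ _≡_ L
    L-injective eq = Fin.↑ˡ-injective r _ _ (Fin.inject≤-injective large large _ _ eq)

    R-injective : Injective _≡_ _≡_ R
    R-injective eq = Fin.↑ʳ-injective m _ _ (Fin.inject≤-injective large large _ _ eq)

  -- A colour is attached to a proof of u < v, so the order proofs are returned together with the
  -- equations about their colours.
  monochromaticOrderedBiclique : (χ : ∀ {u v : Fin n} → u <ᶠ v → Fin M) →
    ∃ λ c → ∃ λ (α : Fin (suc a) → Fin n) → ∃ λ (β : Fin (suc s) → Fin n) →
      Injective _≡_ _≡_ α × Injective _≡_ _≡_ β ×
      ∃ λ (α<β : ∀ i j → α i <ᶠ β j) → ∀ i j → χ (α<β i j) ≡ c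
  monochromaticOrderedBiclique χ
    with c , α , β , α-inj , β-inj , mono ←
      monochromaticBiclique M a s {m} {r} ℕ.≤-refl ℕ.≤-refl (λ x y → χ {L x} {R y} (L<R x y))
    = c , L ∘ α , R ∘ β , α-inj ∘ L-injective , β-inj ∘ R-injective ,
      (λ i j → L<R (α i) (β j)) , mono

subdivisionEdges : ℕ → ℕ → ℕ
subdivisionEdges t p = length (Subdivision.edges (complete t) p)

module _ {G : Graph} {p n N a : ℕ} (V : Fin N → Subset (order G)) (cover : ∀ v → ∃ λ i → v ∈ V i)
  (K⊆G : (complete n ⁽ p ⁾) IsSubgraphOf G) where

  open _IsSubgraphOf_ K⊆G using (embed)
  open SubdivisionProperties (complete n) p using (edge; pathVertex)

  private
    pathAlong : ∀ {u v : Fin n} → u <ᶠ v → Fin (2 + p) → Fin (order G)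
    pathAlong u<v k = embed (pathVertex (edge u<v (<⇒≢ u<v)) k)

    partOf : ∀ {u v : Fin n} → u <ᶠ v → Fin (2 + p) → Fin N
    partOf u<v k = proj₁ (cover (pathAlong u<v k))

    union : (Fin (2 + p) → Fin N) → Subset (order G)
    union c = ⋃ (List.tabulate (V ∘ c))

    partOf≡⇒∈ : (c : Fin (2 + p) → Fin N) → ∀ {u v} (u<v : u <ᶠ v) → partOf u<v ≗ c →
      ∀ k → pathAlong u<v k ∈ union c
    partOf≡⇒∈ c u<v part≡ k = ∈-⋃-tabulate (V ∘ c) k
      (subst (λ z → pathAlong u<v k ∈ V z) (part≡ k) (proj₂ (cover (pathAlong u<v k))))

    -- When all edges of the biclique have colour c, their paths stay in the parts named by c, and
    -- so does the subdivision routed along them.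
    subdivisionInColour : (c : Fin (2 + p) → Fin N) (α : Fin (suc a) → Fin n)
      (β : Fin (suc (subdivisionEdges (suc a) (p + suc p))) → Fin n) →
      Injective _≡_ _≡_ α → Injective _≡_ _≡_ β → (α<β : ∀ i j → α i <ᶠ β j) →
      (∀ i j → partOf (α<β i j) ≗ c) →
      (complete (suc a) ⁽ p + suc p ⁾) IsSubgraphOf (G [ union c ])
    subdivisionInColour c α β α-inj β-inj α<β part≡ =
      subgraph-[] {complete (suc a) ⁽ p + suc p ⁾} {G}
        (IsSubgraphOf-trans {complete (suc a) ⁽ p + suc p ⁾} {complete n ⁽ p ⁾} {G} subgraph K⊆G)
        (union c)
        (embed-elim (λ x → embed x ∈ union c) (λ i j → partOf≡⇒∈ c (α<β i j) (part≡ i j)))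
      where open SubdividedBiclique {n} {suc a} {p} α β α-inj β-inj α<β

  subdivisionInUnion :
    bicliqueOrder (N ^ (2 + p)) a (subdivisionEdges (suc a) (p + suc p)) ≤ n →
    ∃ λ (c : Fin (2 + p) → Fin N) →
      (complete (suc a) ⁽ p + suc p ⁾) IsSubgraphOf (G [ ⋃ (List.tabulate (V ∘ c)) ])
  subdivisionInUnion large =
    -- A colour is a function from 2 + p path positions to N parts, coded as a number below N ^ (2 +
    -- p). Decoding the common colour gives the parts to unite.
    let c , α , β , α-inj , β-inj , α<β , mono = monochromaticOrderedBiclique a _ large
          (λ {u} {v} (u<v : u <ᶠ v) → funToFin (partOf u<v))
    in finToFun c , subdivisionInColour (finToFun c) α β α-inj β-inj α<β
         (λ i j k → trans (sym (Fin.finToFun-funToFin (partOf (α<β i j)) k))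
                          (cong (λ z → finToFun z k) (mono i j)))

-- Bounds

^-distribʳ-* : ∀ x y n → (x * y) ^ n ≡ x ^ n * y ^ n
^-distribʳ-* x y zero    = refl
^-distribʳ-* x y (suc n) = trans (cong (x * y *_) (^-distribʳ-* x y n))
  (ℕ.[m*n]*[o*p]≡[m*o]*[n*p] x y (x ^ n) (y ^ n))

bicliqueCoefficient : ℕ → ℕ → ℕ
bicliqueCoefficient a s = suc a + suc (suc a ^ suc a * s)

-- For positive M each summand is at most a constant times M ^ (2 + a). Polynomial growth suffices
-- because M will be a fixed power of the number of parts.
bicliqueOrder≤ : ∀ M a s .{{_ : NonZero M}} →
  bicliqueOrder M a s ≤ bicliqueCoefficient a s * M ^ (2 + a)
bicliqueOrder≤ M a s = begin
  suc (M * a) + suc (M * suc (M * a) ^ suc a * s)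
    ≤⟨ ℕ.+-mono-≤ m≤ (s≤s (ℕ.*-monoˡ-≤ s (ℕ.*-monoʳ-≤ M (ℕ.^-monoˡ-≤ (suc a) m≤)))) ⟩
  M * suc a + suc (M * (M * suc a) ^ suc a * s)
    ≡⟨ cong (λ z → M * suc a + suc (M * z * s)) (^-distribʳ-* M (suc a) (suc a)) ⟩
  M * suc a + (1 + M * (M ^ suc a * suc a ^ suc a) * s)
    ≤⟨ ℕ.+-mono-≤ (ℕ.*-monoˡ-≤ (suc a) M≤X) (ℕ.+-monoˡ-≤ _ (ℕ.m^n>0 M (2 + a))) ⟩
  X * suc a + (X + M * (M ^ suc a * suc a ^ suc a) * s)
    ≡⟨ collect M (M ^ suc a) (suc a) (suc a ^ suc a) s ⟩
  bicliqueCoefficient a s * X ∎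
  where
  open ≤-Reasoning
  X = M ^ (2 + a)

  m≤ : suc (M * a) ≤ M * suc a
  m≤ = begin
    1 + M * a  ≤⟨ ℕ.+-monoˡ-≤ (M * a) (>-nonZero⁻¹ M) ⟩
    M + M * a  ≡⟨ sym (ℕ.*-suc M a) ⟩
    M * suc a  ∎

  M≤X : M ≤ X
  M≤X = subst (_≤ X) (ℕ.^-identityʳ M) (ℕ.^-monoʳ-≤ M {1} {2 + a} (s≤s z≤n))

  collect : ∀ M Y b k s →
    M * Y * b + (M * Y + M * (Y * k) * s) ≡ (b + suc (k * s)) * (M * Y)
  collect = solve-∀

-- Since f y ^ (d * 3) ≤ y = O(n²), the cube of the left-hand side is below n³.
subpolynomialBound : ∀ {f} → Subpolynomial f → ∀ d .{{_ : NonZero d}} C B →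
  ∃ λ n₀ → ∀ n y → n₀ < n → n ≤ y → y ≤ B * (n * n) → C * f y ^ d ≤ n
-- Beyond n₁ the bound on f applies to y, and C ^ 3 * B ≤ n absorbs the constants. The exponent 3 is
-- chosen to exceed the 2 in n * n.
subpolynomialBound {f} sub d C B = n₁ + C ^ 3 * B , bound
  where
  instance
    d*3≢0 : NonZero (d * 3)
    d*3≢0 = ℕ.m*n≢0 d 3

  n₁ = proj₁ (sub (d * 3))

  bound : ∀ n y → n₁ + C ^ 3 * B < n → n ≤ y → y ≤ B * (n * n) → C * f y ^ d ≤ n
  bound n y n₀<n n≤y y≤ = ℕ.≮⇒≥ (λ n<z → ℕ.<⇒≱ (ℕ.^-monoˡ-< 3 n<z) cube≤)
    where
    open ≤-Reasoning
    cube≤ : (C * f y ^ d) ^ 3 ≤ n ^ 3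
    cube≤ = begin
      (C * f y ^ d) ^ 3        ≡⟨ ^-distribʳ-* C (f y ^ d) 3 ⟩
      C ^ 3 * (f y ^ d) ^ 3    ≡⟨ cong (C ^ 3 *_) (ℕ.^-*-assoc (f y) d 3) ⟩
      C ^ 3 * f y ^ (d * 3)    ≤⟨ ℕ.*-monoʳ-≤ (C ^ 3)
                                   (proj₂ (proj₂ (sub (d * 3)) y (begin
                                     n₁               ≤⟨ ℕ.m≤m+n n₁ (C ^ 3 * B) ⟩
                                     n₁ + C ^ 3 * B   ≤⟨ ℕ.<⇒≤ n₀<n ⟩
                                     n                ≤⟨ n≤y ⟩
                                     y                ∎))) ⟩
      C ^ 3 * y                ≤⟨ ℕ.*-monoʳ-≤ (C ^ 3) y≤ ⟩
      C ^ 3 * (B * (n * n))    ≡⟨ sym (ℕ.*-assoc (C ^ 3) B (n * n)) ⟩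
      C ^ 3 * B * (n * n)      ≤⟨ ℕ.*-monoˡ-≤ (n * n)
                                   (ℕ.≤-trans (ℕ.m≤n+m (C ^ 3 * B) n₁) (ℕ.<⇒≤ n₀<n)) ⟩
      n * (n * n)              ≡⟨ cong (λ z → n * (n * z)) (sym (ℕ.*-identityʳ n)) ⟩
      n ^ 3                    ∎

-- Decompositions

-- Parts must be nonempty, so the empty vertex set receives no part at all and every other set
-- receives one.
trivialPartition : ∀ n → ∃ λ N → N ≤ 1 × ∃ λ (V : Fin N → Subset n) → IsPartition V
trivialPartition zero    = 0 , z≤n , (λ ()) , record { nonempty = λ () ; cover = λ () }
trivialPartition (suc n) = 1 , s≤s z≤n , (λ _ → ⊤) , record
  { nonempty = λ _ → zero , ∈⊤
  ; cover    = λ _ → zero , ∈⊤ , λ { {zero} _ → refl }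
  }

-- The class serves as its own 𝒟 with f constantly 1: heredity keeps every induced subgraph in it.
⋆-extensive : ∀ {ℓ ℓ′} (Π : HereditaryClassProperty ℓ ℓ′) {𝒞} → Holds Π 𝒞 → (Π ⋆) 𝒞
⋆-extensive Π {𝒞} 𝒞∈Π = hereditary Π 𝒞∈Π , λ p →
  (λ _ → 1) , (λ _ → ℕ.≤-refl) ,
  (λ k → 1 , λ n 1≤n → ℕ.≤-refl , subst (_≤ n) (sym (ℕ.^-zeroˡ k)) 1≤n) ,
  𝒞 , 𝒞∈Π , λ G G∈𝒞 →
    let N , N≤1 , V , part = trivialPartition (order G)
    in N , N≤1 , V , part , λ i → Hereditary.induced-closed (hereditary Π 𝒞∈Π) _ G∈𝒞

-- Bounding subdivided cliques

module _ {ℓ : Level} {𝒞 : Class ℓ} (𝒞∈Π⋆ : (nowhereDense ℓ ⋆) 𝒞) (p : ℕ) where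

  private
    f = proj₁ (proj₂ 𝒞∈Π⋆ (2 + p))
    sub = proj₁ (proj₂ (proj₂ (proj₂ 𝒞∈Π⋆ (2 + p))))
    decomposition = proj₂ (proj₂ (proj₂ (proj₂ 𝒞∈Π⋆ (2 + p))))
    𝒟 = proj₁ decomposition
    𝒟-nowhereDense = proj₂ (proj₁ (proj₂ decomposition))
    decompose = proj₂ (proj₂ decomposition)

    a s d : ℕ
    -- Joining two paths with p inner vertices at a middle vertex yields p + suc p inner vertices.
    -- At this depth a bounds the cliques for 𝒟, so a clique on suc a vertices is to be found.
    a = proj₁ 𝒟-nowhereDense (p + suc p)
    s = subdivisionEdges (suc a) (p + suc p)
    -- Degree 2 + a in the number of colours N ^ (2 + p) is degree d in N.
    d = (2 + p) * (2 + a)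

    threshold = subpolynomialBound {f} sub d (bicliqueCoefficient a s) (suc p)

  subdividedCliqueBound : ℕ
  subdividedCliqueBound = proj₁ threshold

  private
    -- The number of parts is controlled by the order of G; only when that order is at most the size
    -- of the subdivision is it small compared with n.
    spanning⇒bounded : ∀ {G n} → 𝒞 G → (complete n ⁽ p ⁾) IsSubgraphOf G →
      order G ≤ Subdivision.size (complete n) p → n ≤ subdividedCliqueBound
    spanning⇒bounded {G} {n} G∈𝒞 K⊆G G≤K = ℕ.≮⇒≥ impossible
      where
      impossible : ¬ subdividedCliqueBound < n
      impossible n₀<n with decompose G G∈𝒞
      ... | N , N≤f , V , V-partition , union∈𝒟 = ℕ.1+n≰n
        (proj₂ 𝒟-nowhereDense (p + suc p) (complete (suc a)) _ (union∈𝒟 (proj₁ inUnion))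
          (proj₂ inUnion) (suc a) (cliqueNumber-complete (suc a)))
        where
        cover : ∀ v → ∃ λ i → v ∈ V i
        cover v = let i , v∈ , _ = IsPartition.cover V-partition v in i , v∈

        1≤n : 1 ≤ n
        1≤n = ℕ.≤-trans (s≤s z≤n) n₀<n

        n≤G : n ≤ order G
        n≤G = ℕ.≤-trans (ℕ.m≤m+n n _) (subgraph⇒order≤ {complete n ⁽ p ⁾} {G} K⊆G)

        -- G has a vertex because n is positive, and the part containing it shows that N, hence the
        -- number of colours, is positive.
        N≢0 : NonZero N
        N≢0 = nonZeroIndex (proj₁ (cover (inject≤ zero (ℕ.≤-trans 1≤n n≤G))))

        large : bicliqueOrder (N ^ (2 + p)) a s ≤ n
        large = begin
          bicliqueOrder (N ^ (2 + p)) a s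
            ≤⟨ bicliqueOrder≤ (N ^ (2 + p)) a s {{ℕ.m^n≢0 N (2 + p) {{N≢0}}}} ⟩
          bicliqueCoefficient a s * (N ^ (2 + p)) ^ (2 + a)
            ≡⟨ cong (bicliqueCoefficient a s *_) (ℕ.^-*-assoc N (2 + p) (2 + a)) ⟩
          bicliqueCoefficient a s * N ^ d
            ≤⟨ ℕ.*-monoʳ-≤ (bicliqueCoefficient a s) (ℕ.^-monoˡ-≤ d N≤f) ⟩
          bicliqueCoefficient a s * f (order G) ^ d
            ≤⟨ proj₂ threshold n (order G) n₀<n n≤G
                 (ℕ.≤-trans G≤K (SubdivisionProperties.size-bound (complete n) p 1≤n)) ⟩
          n ∎
          where open ≤-Reasoning

        inUnion = subdivisionInUnion {G} {p} {n} {N} {a} V cover K⊆G large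

  -- G is replaced by the subgraph induced on the image of the embedding, which stays in 𝒞 by
  -- heredity and has no more vertices than the subdivided clique.
  subdividedClique-bounded : ∀ {G n} → 𝒞 G → (complete n ⁽ p ⁾) IsSubgraphOf G →
    n ≤ subdividedCliqueBound
  subdividedClique-bounded {G} {n} G∈𝒞 K⊆G = spanning⇒bounded
    (Hereditary.induced-closed (proj₁ 𝒞∈Π⋆) (image K⊆G) G∈𝒞)
    (subgraph-[] K⊆G (image K⊆G) (embed∈image K⊆G)) (∣image∣≤ K⊆G)

-- A clique of size ω in H yields a subdivided complete graph of order ω inside the subdivision of
-- H, so bounding subdivided complete graphs is enough.
nowhereDense-⋆ : ∀ {ℓ} {𝒞 : Class ℓ} → (nowhereDense ℓ ⋆) 𝒞 → NowhereDense 𝒞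
nowhereDense-⋆ {𝒞 = 𝒞} 𝒞∈Π⋆ = subdividedCliqueBound 𝒞∈Π⋆ , bound
  where
  bound : ∀ p H G → 𝒞 G → (H ⁽ p ⁾) IsSubgraphOf G →
    ∀ ω → IsCliqueNumber H ω → ω ≤ subdividedCliqueBound 𝒞∈Π⋆ p
  bound p H G G∈𝒞 H⊆G _ ((S , clique , refl) , _) =
    subdividedClique-bounded 𝒞∈Π⋆ p {G} {∣ S ∣} G∈𝒞
      (IsSubgraphOf-trans {complete ∣ S ∣ ⁽ p ⁾} {H ⁽ p ⁾} {G}
        (clique⇒completeSubdivision {H} p {S} clique) H⊆G)

mainTheorem6 : (ℓ : Level) → IsDecompositionHorizon (nowhereDense ℓ)
mainTheorem6 ℓ 𝒞 = mk⇔
  (λ 𝒞∈Π⋆ → proj₁ 𝒞∈Π⋆ , nowhereDense-⋆ 𝒞∈Π⋆)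
  (⋆-extensive (nowhereDense ℓ))
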